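{- Let $C$ be an extended linear code of length $5$ over $\mathbb{Z}_N$ and let $g=(g_{ji})$ be an $m\times5$ matrix that generates $C$, with columns indexed by $i=0,\dots,4$, such that the greatest common divisor of $N$ and all the entries of $g$ is $1$. Put $\gcd_i=\gcd(g_{1i},\dots,g_{mi},N)$. If $C$ is thin, then at least one of the $\gcd_i$ is $N/\alpha$ with $\alpha\in\{2,3,4\}$.
   Context: $\mathbb{Z}_N=\mathbb{Z}/N\mathbb{Z}$; its elements are identified with the representatives $0,1,\dots,N-1$, and gcd's are taken of these integers. A linear code of length $n$ over $\mathbb{Z}_N$ is a submodule $C\subseteq\mathbb{Z}_N^n$; its elements are called words; a matrix generates $C$ if its rows generate $C$. $C$ is extended if every word has coordinate sum $0\bmod N$. An extended code is thin if it contains no word all of whose entries are nonzero.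
   Formalization: The claim is proved under the added assumption that no coordinate vanishes on all of C (no zero column in g); without it the claim fails, e.g. N=5 and the single row (0,1,1,1,2), which is extended and thin with gcd_i = 5,1,1,1,1. -}

module Defs where

open import Data.Fin.Base using (Fin; toℕ)
open import Data.Nat.Base as ℕ using (ℕ; NonZero)
open import Data.Nat.Divisibility using (_∣_)
open import Data.Nat.DivMod using (_mod_)
open import Data.Nat.GCD using (gcd)
open import Data.Product.Base using (_×_; ∃-syntax)
open import Data.Vec.Base using (Vec; []; _∷_; map; zipWith; replicate; lookup; foldr′; concat; sum)
open import Function.Bundles using (_⇔_)
open import Level using (Level)
open import Relation.Binary.PropositionalEquality using (_≡_; _≢_)
open import Relation.Nullary.Negation using (¬_)
open import Relation.Unary using (Pred; _∈_)

private
  variable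
    ℓ : Level
    m n : ℕ

-- ℤ/Nℤ with its elements identified with the representatives 0, …, N-1.
ℤ/ : ℕ → Set
ℤ/ N = Fin N

Word : ℕ → ℕ → Set
Word N n = Vec (ℤ/ N) n

-- An m × n matrix, as the vector of its rows.
Matrix : ℕ → ℕ → ℕ → Set
Matrix N m n = Vec (Word N n) m

module _ (N : ℕ) .{{_ : NonZero N}} where

  infixl 6 _+ᴺ_ _+ʷ_
  infixl 7 _*ᴺ_ _·ʷ_

  0ᴺ : ℤ/ N
  0ᴺ = 0 mod N

  _+ᴺ_ _*ᴺ_ : ℤ/ N → ℤ/ N → ℤ/ N
  a +ᴺ b = (toℕ a ℕ.+ toℕ b) mod N
  a *ᴺ b = (toℕ a ℕ.* toℕ b) mod N

  0ʷ : Word N n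
  0ʷ = replicate _ 0ᴺ

  _+ʷ_ : Word N n → Word N n → Word N n
  _+ʷ_ = zipWith _+ᴺ_

  _·ʷ_ : ℤ/ N → Word N n → Word N n
  a ·ʷ w = map (a *ᴺ_) w

  record IsLinearCode (C : Pred (Word N n) ℓ) : Set ℓ where
    field
      0-closed : 0ʷ ∈ C
      +-closed : ∀ {v w} → v ∈ C → w ∈ C → v +ʷ w ∈ C
      ·-closed : ∀ a {w} → w ∈ C → a ·ʷ w ∈ C

  linearCombination : Vec (ℤ/ N) m → Matrix N m n → Word N n
  linearCombination []       []       = 0ʷ
  linearCombination (a ∷ as) (r ∷ rs) = a ·ʷ r +ʷ linearCombination as rs

  Generates : Matrix N m n → Pred (Word N n) ℓ → Set ℓ
  Generates g C = ∀ w → w ∈ C ⇔ (∃[ as ] w ≡ linearCombination as g)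

  Extended : Pred (Word N n) ℓ → Set ℓ
  Extended C = ∀ {w} → w ∈ C → N ∣ sum (map toℕ w)

  Thin : Pred (Word N n) ℓ → Set ℓ
  Thin C = ¬ (∃[ w ] w ∈ C × (∀ i → lookup w i ≢ 0ᴺ))

  -- No coordinate vanishes on the whole code.  A code with an identically
  -- zero coordinate is thin for a trivial reason: for instance, the code over
  -- ℤ/5ℤ generated by (0,1,1,1,2) is extended and thin, and the greatest common
  -- divisors of its columns with 5 are 5, 1, 1, 1, 1.
  NoZeroCoordinate : Pred (Word N n) ℓ → Set ℓ
  NoZeroCoordinate C = ∀ i → ∃[ w ] w ∈ C × lookup w i ≢ 0ᴺ

-- The greatest common divisor of N and the given residues.
gcdWith : ∀ N → Vec (ℤ/ N) n → ℕ
gcdWith N v = foldr′ gcd N (map toℕ v)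

gcdAll : ∀ N → Matrix N m n → ℕ
gcdAll N g = gcdWith N (concat g)

gcdColumn : ∀ N → Matrix N m n → Fin n → ℕ
gcdColumn N g i = gcdWith N (map (λ r → lookup r i) g)

{-# OPTIONS --safe #-}
module Submission where

-- A coordinate i whose projection takes at least 5 values on C vanishes on at
-- most a fifth of the words.  If this held for every i, the five vanishing sets,
-- which all contain the zero word, could not cover C.  The projection to
-- coordinate i takes the values 0, gcdᵢ, 2 gcdᵢ, …, hence N/gcdᵢ of them, and
-- N/gcdᵢ ≠ 1 because the coordinate is not identically zero.

open import Defs
open import Data.Empty using (⊥)
open import Data.Fin.Base using (Fin; zero; suc; toℕ; combine; funToFin; finToFun; punchIn)
open import Data.Fin.Properties
  using (toℕ-injective; toℕ-fromℕ<; toℕ<n; any?; pigeonhole; combine-injective;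
         finToFun-funToFin; punchInᵢ≢i)
  renaming (_≟_ to _≟ᶠ_)
open import Data.List.Base using ([]; _∷_)
open import Data.List.Membership.Propositional using (find; lose) renaming (_∈_ to _∈ˡ_)
open import Data.List.Relation.Unary.Any using (here; there) renaming (any? to anyᴸ?)
open import Data.Nat.Base
  using (ℕ; zero; suc; NonZero; _+_; _*_; _∸_; _^_; _≤_; _<_; s<s⁻¹; ≢-nonZero)
open import Data.Nat.Divisibility
  using (_∣_; quotient; m∣n⇒n≡m*quotient; ∣-refl; ∣-trans; ∣⇒≤; _∣0; ∣m∣n⇒∣m+n; ∣n⇒∣m*n; %-presˡ-∣)
open import Data.Nat.DivMod
  using (_%_; _mod_; m%n<n; m<n⇒m%n≡m; %-distribˡ-+; %-distribˡ-*; [m+n]%n≡m%n; [m+kn]%n≡m%n)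
open import Data.Nat.GCD using (gcd; gcd-GCD; gcd[m,n]∣m; gcd[m,n]∣n; module Bézout)
open import Data.Nat.Properties
  using (_≟_; <⇒≤; <⇒≢; n≮0; n<1+n; ≤-<-trans; <-≤-trans; m≤m+n; m+[n∸m]≡n; +-assoc;
         *-comm; *-identityʳ; *-zeroʳ; *-cancelʳ-≡; *-monoˡ-<; m*n≢0⇒m≢0)
open import Data.Nat.Tactic.RingSolver using (solve-∀)
open import Data.Product.Base using (_×_; _,_; proj₁; proj₂; ∃-syntax)
open import Data.Vec.Base using (Vec; []; _∷_; map; lookup)
open import Data.Vec.Properties
  using (lookup-map; lookup-zipWith; lookup-replicate; tabulate∘lookup; tabulate-cong)
open import Function.Base using (_∘_; it)
open import Function.Bundles using (Equivalence)
open import Function.Definitions using (Injective)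
open import Level using (Level)
open import Relation.Binary.PropositionalEquality
  using (_≡_; _≢_; refl; sym; trans; cong; cong₂; subst; module ≡-Reasoning)
open import Relation.Nullary using (¬_; Dec; yes; no; contradiction)
open import Relation.Nullary.Decidable using (map′)
open import Relation.Unary using (Pred; _∈_)

private
  variable
    ℓ : Level
    A : Set
    m n : ℕ

-- The orbit of a point outside the image of an injective map never repeats.
injective⇒¬missing : (encode : A → Fin n) → Injective _≡_ _≡_ encode →
  (P : Pred A ℓ) (F : A → A) → (∀ {a} → a ∈ P → F a ∈ P) →
  (∀ {a b} → a ∈ P → b ∈ P → F a ≡ F b → a ≡ b) →
  ∀ {a₀} → a₀ ∈ P → (∀ {a} → a ∈ P → F a ≢ a₀) → ⊥
injective⇒¬missing {n = n} encode encode-inj P F F-closed F-inj {a₀} a₀∈P missing =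
  let i , j , i<j , eq = pigeonhole (n<1+n n) (encode ∘ orbit ∘ toℕ)
  in orbit-distinct i<j (encode-inj eq)
  where
  orbit : ℕ → _
  orbit zero    = a₀
  orbit (suc k) = F (orbit k)

  orbit∈P : ∀ k → orbit k ∈ P
  orbit∈P zero    = a₀∈P
  orbit∈P (suc k) = F-closed (orbit∈P k)

  orbit-distinct : ∀ {i j} → i < j → orbit i ≢ orbit j
  orbit-distinct {zero}  {suc j} _   eq = missing (orbit∈P j) (sym eq)
  orbit-distinct {suc i} {suc j} i<j eq =
    orbit-distinct (s<s⁻¹ i<j) (F-inj (orbit∈P i) (orbit∈P j) eq)

lookup-injective : {v w : Vec A n} → (∀ i → lookup v i ≡ lookup w i) → v ≡ w
lookup-injective {v = v} {w} eq =
  trans (sym (tabulate∘lookup v)) (trans (tabulate-cong eq) (tabulate∘lookup w))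

encodeVec : Vec (Fin m) n → Fin (m ^ n)
encodeVec v = funToFin (lookup v)

encodeVec-injective : Injective _≡_ _≡_ (encodeVec {m} {n})
encodeVec-injective {x = v} {w} eq = lookup-injective λ i →
  trans (sym (finToFun-funToFin (lookup v) i))
    (trans (cong (λ k → finToFun k i) eq) (finToFun-funToFin (lookup w) i))

bézout-mod : ∀ N .{{_ : NonZero N}} a b →
  ∃[ x ] ∃[ y ] (x * a + y * b) % N ≡ gcd a b % N
bézout-mod N@(suc k) a b with Bézout.identity (gcd-GCD a b)
... | Bézout.+- x y eq = x , y * k , (begin
  (x * a + y * k * b) % N           ≡⟨ cong (λ z → (z + y * k * b) % N) eq ⟨
  (gcd a b + y * b + y * k * b) % N ≡⟨ cong (_% N) (rearrange (gcd a b) y k b) ⟩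
  (gcd a b + (y * b) * N) % N       ≡⟨ [m+kn]%n≡m%n (gcd a b) (y * b) N ⟩
  gcd a b % N                       ∎)
  where
  open ≡-Reasoning
  rearrange : ∀ d y k b → d + y * b + y * k * b ≡ d + (y * b) * suc k
  rearrange = solve-∀
... | Bézout.-+ x y eq = x * k , y , (begin
  (x * k * a + y * b) % N             ≡⟨ cong (λ z → (x * k * a + z) % N) eq ⟨
  (x * k * a + (gcd a b + x * a)) % N ≡⟨ cong (_% N) (rearrange (gcd a b) x k a) ⟩
  (gcd a b + (x * a) * N) % N         ≡⟨ [m+kn]%n≡m%n (gcd a b) (x * a) N ⟩
  gcd a b % N                         ∎)
  where
  open ≡-Reasoning
  rearrange : ∀ d x k a → x * k * a + (d + x * a) ≡ d + (x * a) * suc k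
  rearrange = solve-∀

gcdWith∣N : ∀ N (v : Vec (ℤ/ N) n) → gcdWith N v ∣ N
gcdWith∣N N []      = ∣-refl
gcdWith∣N N (a ∷ v) = ∣-trans (gcd[m,n]∣n (toℕ a) (gcdWith N v)) (gcdWith∣N N v)

module _ (N : ℕ) .{{_ : NonZero N}} where

  private
    infixl 5 _⊕_ _⊕ʷ_
    infixl 6 _⊗_

    _⊕_ _⊗_ : ℤ/ N → ℤ/ N → ℤ/ N
    _⊕_ = _+ᴺ_ N
    _⊗_ = _*ᴺ_ N

    _⊕ʷ_ : Word N n → Word N n → Word N n
    _⊕ʷ_ = _+ʷ_ N

  toℕ-mod : ∀ a → toℕ (a mod N) ≡ a % N
  toℕ-mod a = toℕ-fromℕ< (m%n<n a N)

  mod-cong : ∀ {a b} → a % N ≡ b % N → a mod N ≡ b mod N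
  mod-cong {a} {b} eq = toℕ-injective (trans (toℕ-mod a) (trans eq (sym (toℕ-mod b))))

  mod-toℕ : ∀ a → toℕ a mod N ≡ a
  mod-toℕ a = toℕ-injective (trans (toℕ-mod (toℕ a)) (m<n⇒m%n≡m (toℕ<n a)))

  mod-+ : ∀ a b → a mod N ⊕ b mod N ≡ (a + b) mod N
  mod-+ a b = mod-cong (trans
    (cong₂ (λ x y → (x + y) % N) (toℕ-mod a) (toℕ-mod b))
    (sym (%-distribˡ-+ a b N)))

  mod-* : ∀ a b → a mod N ⊗ b mod N ≡ (a * b) mod N
  mod-* a b = mod-cong (trans
    (cong₂ (λ x y → (x * y) % N) (toℕ-mod a) (toℕ-mod b))
    (sym (%-distribˡ-* a b N)))

  mod-injective : ∀ {a b} → a < N → b < N → a mod N ≡ b mod N → a ≡ b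
  mod-injective {a} {b} a<N b<N eq = begin
    a             ≡⟨ m<n⇒m%n≡m a<N ⟨
    a % N         ≡⟨ toℕ-mod a ⟨
    toℕ (a mod N) ≡⟨ cong toℕ eq ⟩
    toℕ (b mod N) ≡⟨ toℕ-mod b ⟩
    b % N         ≡⟨ m<n⇒m%n≡m b<N ⟩
    b             ∎
    where open ≡-Reasoning

  ⊕-identityˡ : ∀ a → 0ᴺ N ⊕ a ≡ a
  ⊕-identityˡ a = begin
    0ᴺ N ⊕ a              ≡⟨ cong (0ᴺ N ⊕_) (mod-toℕ a) ⟨
    0 mod N ⊕ toℕ a mod N ≡⟨ mod-+ 0 (toℕ a) ⟩
    toℕ a mod N           ≡⟨ mod-toℕ a ⟩
    a                     ∎
    where open ≡-Reasoning

  ⊕-cancelʳ : ∀ c {a b} → a ⊕ c ≡ b ⊕ c → a ≡ b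
  ⊕-cancelʳ c {a} {b} eq =
    trans (sym (undo a)) (trans (cong (_⊕ (N ∸ toℕ c) mod N) eq) (undo b))
    where
    open ≡-Reasoning
    undo : ∀ x → x ⊕ c ⊕ (N ∸ toℕ c) mod N ≡ x
    undo x = begin
      x ⊕ c ⊕ (N ∸ toℕ c) mod N           ≡⟨ mod-+ (toℕ x + toℕ c) (N ∸ toℕ c) ⟩
      (toℕ x + toℕ c + (N ∸ toℕ c)) mod N ≡⟨ cong (_mod N) (+-assoc (toℕ x) _ _) ⟩
      (toℕ x + (toℕ c + (N ∸ toℕ c))) mod N
        ≡⟨ cong (λ z → (toℕ x + z) mod N) (m+[n∸m]≡n (<⇒≤ (toℕ<n c))) ⟩
      (toℕ x + N) mod N                   ≡⟨ mod-cong ([m+n]%n≡m%n (toℕ x) N) ⟩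
      toℕ x mod N                         ≡⟨ mod-toℕ x ⟩
      x                                   ∎

  ⊕ʷ-cancelʳ : (u : Word N n) {v w : Word N n} → v ⊕ʷ u ≡ w ⊕ʷ u → v ≡ w
  ⊕ʷ-cancelʳ u {v} {w} eq = lookup-injective λ i → ⊕-cancelʳ (lookup u i)
    (trans (sym (lookup-zipWith _⊕_ i v u))
      (trans (cong (λ z → lookup z i) eq) (lookup-zipWith _⊕_ i w u)))

  lookup-⊕ʷ-zero : ∀ (v u : Word N n) {i} → lookup v i ≡ 0ᴺ N →
    lookup (v ⊕ʷ u) i ≡ lookup u i
  lookup-⊕ʷ-zero v u {i} v≡0 = trans (lookup-zipWith _⊕_ i v u)
    (trans (cong (_⊕ lookup u i) v≡0) (⊕-identityˡ (lookup u i)))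

  -- For each i, the n words x i j move the kernel of coordinate i to n disjoint
  -- translates.  If vanishing picks a zero coordinate of every word, then
  -- (w , j) ↦ (w + x i j , i) with i = vanishing w is an injection of C × Fin n
  -- into itself, but it misses the images of the other zero coordinates of 0ʷ.
  separated⇒¬cover : {C : Pred (Word N (suc (suc n))) ℓ} → IsLinearCode N C →
    (x : Fin (suc (suc n)) → Fin (suc (suc n)) → Word N (suc (suc n))) →
    (∀ i j → x i j ∈ C) →
    (∀ i → Injective _≡_ _≡_ (λ j → lookup (x i j) i)) →
    (vanishing : Word N (suc (suc n)) → Fin (suc (suc n))) →
    ¬ (∀ {w} → w ∈ C → lookup w (vanishing w) ≡ 0ᴺ N)
  separated⇒¬cover {n = n} {C = C} linear x x∈C x-inj vanishing vanishes =
    injective⇒¬missing encode encode-injective P F F-closed F-injective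
      {translate (0ʷ N) zero i₀} (+-closed 0-closed (x∈C i₀ zero)) missing
    where
    open IsLinearCode linear

    WordIndex : Set
    WordIndex = Word N (suc (suc n)) × Fin (suc (suc n))

    encode : WordIndex → Fin (N ^ suc (suc n) * suc (suc n))
    encode (w , i) = combine (encodeVec w) i

    encode-injective : Injective _≡_ _≡_ encode
    encode-injective {v , i} {w , j} eq =
      let ev≡ew , i≡j = combine-injective (encodeVec v) i (encodeVec w) j eq
      in cong₂ _,_ (encodeVec-injective ev≡ew) i≡j

    P : Pred WordIndex _
    P (w , _) = w ∈ C

    translate : Word N (suc (suc n)) → Fin (suc (suc n)) → Fin (suc (suc n)) → WordIndex
    translate w j i = w ⊕ʷ x i j , i

    translate-injective : ∀ {v w j k i i′} → lookup v i ≡ 0ᴺ N → lookup w i′ ≡ 0ᴺ N →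
      translate v j i ≡ translate w k i′ → v ≡ w × j ≡ k × i ≡ i′
    translate-injective {v} {w} {j} {k} {i} {i′} v≡0 w≡0 eq with cong proj₂ eq
    ... | refl with x-inj i (trans (sym (lookup-⊕ʷ-zero v (x i j) v≡0))
                      (trans (cong (λ p → lookup (proj₁ p) i) eq)
                        (lookup-⊕ʷ-zero w (x i k) w≡0)))
    ...   | refl = ⊕ʷ-cancelʳ (x i j) (cong proj₁ eq) , refl , refl

    F : WordIndex → WordIndex
    F (w , j) = translate w j (vanishing w)

    F-closed : ∀ {p} → p ∈ P → F p ∈ P
    F-closed {w , j} w∈C = +-closed w∈C (x∈C (vanishing w) j)

    F-injective : ∀ {p q} → p ∈ P → q ∈ P → F p ≡ F q → p ≡ q
    F-injective v∈C w∈C eq =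
      let v≡w , j≡k , _ = translate-injective (vanishes v∈C) (vanishes w∈C) eq
      in cong₂ _,_ v≡w j≡k

    i₀ : Fin (suc (suc n))
    i₀ = punchIn (vanishing (0ʷ N)) zero

    missing : ∀ {p} → p ∈ P → F p ≢ translate (0ʷ N) zero i₀
    missing w∈C eq =
      let w≡0 , _ , i≡i₀ = translate-injective (vanishes w∈C) (lookup-replicate i₀ (0ᴺ N)) eq
      in punchInᵢ≢i (vanishing (0ʷ N)) zero (trans (sym i≡i₀) (cong vanishing w≡0))

  separated⇒¬thin : {C : Pred (Word N (suc (suc n))) ℓ} → IsLinearCode N C →
    (x : Fin (suc (suc n)) → Fin (suc (suc n)) → Word N (suc (suc n))) →
    (∀ i j → x i j ∈ C) →
    (∀ i → Injective _≡_ _≡_ (λ j → lookup (x i j) i)) →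
    ¬ Thin N C
  separated⇒¬thin {n = n} {C = C} linear x x∈C x-inj thin =
    separated⇒¬cover linear x x∈C x-inj (λ w → choose w (zeroCoordinate? w))
      (λ {w} w∈C → choose-vanishes w∈C (zeroCoordinate? w))
    where
    zeroCoordinate? : (w : Word N (suc (suc n))) → Dec (∃[ i ] lookup w i ≡ 0ᴺ N)
    zeroCoordinate? w = any? (λ i → lookup w i ≟ᶠ 0ᴺ N)

    choose : (w : Word N (suc (suc n))) → Dec (∃[ i ] lookup w i ≡ 0ᴺ N) → Fin (suc (suc n))
    choose _ (yes (i , _)) = i
    choose _ (no _)        = zero

    choose-vanishes : ∀ {w} → w ∈ C → (d : Dec (∃[ i ] lookup w i ≡ 0ᴺ N)) →
      lookup w (choose w d) ≡ 0ᴺ N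
    choose-vanishes w∈C (yes (_ , eq)) = eq
    choose-vanishes {w} w∈C (no ¬zero) =
      contradiction (w , w∈C , λ i eq → ¬zero (i , eq)) thin

  lookup-linearCombination-∷ : ∀ a (as : Vec (ℤ/ N) m) r (g : Matrix N m n) i →
    lookup (linearCombination N (a ∷ as) (r ∷ g)) i ≡
    a ⊗ lookup r i ⊕ lookup (linearCombination N as g) i
  lookup-linearCombination-∷ a as r g i = trans
    (lookup-zipWith _⊕_ i (map (a ⊗_) r) (linearCombination N as g))
    (cong (_⊕ lookup (linearCombination N as g) i) (lookup-map i (a ⊗_) r))

  multiple-attained : (g : Matrix N m n) (i : Fin n) (t : ℕ) →
    ∃[ as ] lookup (linearCombination N as g) i ≡ (t * gcdColumn N g i) mod N
  multiple-attained []      i t =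
    [] , trans (lookup-replicate i (0ᴺ N)) (mod-cong (sym ([m+kn]%n≡m%n 0 t N)))
  multiple-attained (r ∷ g) i t with bézout-mod N (toℕ (lookup r i)) (gcdColumn N g i)
  ... | x , y , bézout with multiple-attained g i (t * y)
  ...   | as , eq = (t * x) mod N ∷ as , (begin
    lookup (linearCombination N ((t * x) mod N ∷ as) (r ∷ g)) i
      ≡⟨ lookup-linearCombination-∷ ((t * x) mod N) as r g i ⟩
    (t * x) mod N ⊗ lookup r i ⊕ lookup (linearCombination N as g) i
      ≡⟨ cong₂ (λ u v → (t * x) mod N ⊗ u ⊕ v) (sym (mod-toℕ (lookup r i))) eq ⟩
    (t * x) mod N ⊗ c mod N ⊕ (t * y * d) mod N
      ≡⟨ cong (_⊕ (t * y * d) mod N) (mod-* (t * x) c) ⟩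
    (t * x * c) mod N ⊕ (t * y * d) mod N
      ≡⟨ mod-+ (t * x * c) (t * y * d) ⟩
    (t * x * c + t * y * d) mod N
      ≡⟨ cong (_mod N) (factor t x c y d) ⟩
    (t * (x * c + y * d)) mod N
      ≡⟨ mod-* t (x * c + y * d) ⟨
    t mod N ⊗ (x * c + y * d) mod N
      ≡⟨ cong (t mod N ⊗_) (mod-cong bézout) ⟩
    t mod N ⊗ gcd c d mod N
      ≡⟨ mod-* t (gcd c d) ⟩
    (t * gcd c d) mod N ∎)
    where
    open ≡-Reasoning
    c = toℕ (lookup r i)
    d = gcdColumn N g i
    factor : ∀ t x c y d → t * x * c + t * y * d ≡ t * (x * c + y * d)
    factor = solve-∀

  ∣toℕ-mod : ∀ {d a} → d ∣ N → d ∣ a → d ∣ toℕ (a mod N)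
  ∣toℕ-mod {d} {a} d∣N d∣a = subst (d ∣_) (sym (toℕ-mod a)) (%-presˡ-∣ d∣a d∣N)

  divides-linearCombination : ∀ {d} (as : Vec (ℤ/ N) m) (g : Matrix N m n) i → d ∣ N →
    d ∣ gcdColumn N g i → d ∣ toℕ (lookup (linearCombination N as g) i)
  divides-linearCombination {d = d} [] [] i d∣N _ =
    subst (λ z → d ∣ toℕ z) (sym (lookup-replicate i (0ᴺ N))) (∣toℕ-mod d∣N (d ∣0))
  divides-linearCombination {d = d} (a ∷ as) (r ∷ g) i d∣N d∣gcd =
    subst (λ z → d ∣ toℕ z) (sym (lookup-linearCombination-∷ a as r g i))
      (∣toℕ-mod d∣N (∣m∣n⇒∣m+n
        (∣toℕ-mod d∣N (∣n⇒∣m*n (toℕ a) (∣-trans d∣gcd (gcd[m,n]∣m c e))))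
        (divides-linearCombination as g i d∣N (∣-trans d∣gcd (gcd[m,n]∣n c e)))))
    where
    c = toℕ (lookup r i)
    e = gcdColumn N g i

  gcdColumn<N : {C : Pred (Word N n) ℓ} (g : Matrix N m n) → Generates N g C →
    NoZeroCoordinate N C → ∀ i → gcdColumn N g i < N
  gcdColumn<N g gen nonzero i with nonzero i
  ... | w , w∈C , w≢0 with Equivalence.to (gen w) w∈C
  ...   | as , refl = ≤-<-trans (∣⇒≤ {{≢-nonZero wᵢ≢0}} gcd∣wᵢ) (toℕ<n (lookup w i))
    where
    gcd∣wᵢ : gcdColumn N g i ∣ toℕ (lookup w i)
    gcd∣wᵢ = divides-linearCombination as g i (gcdWith∣N N (map (λ r → lookup r i) g)) ∣-refl

    wᵢ≢0 : toℕ (lookup w i) ≢ 0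
    wᵢ≢0 eq = w≢0 (trans (sym (mod-toℕ (lookup w i))) (cong (_mod N) eq))

  large-quotients⇒¬thin : {C : Pred (Word N (suc (suc n))) ℓ} → IsLinearCode N C →
    (g : Matrix N m (suc (suc n))) → Generates N g C →
    (∀ i → ∃[ α ] suc (suc n) ≤ α × gcdColumn N g i * α ≡ N) → ¬ Thin N C
  large-quotients⇒¬thin {n = n} {C = C} linear g gen large =
    separated⇒¬thin linear x x∈C x-inj
    where
    x : Fin (suc (suc n)) → Fin (suc (suc n)) → Word N (suc (suc n))
    x i j = linearCombination N (proj₁ (multiple-attained g i (toℕ j))) g

    x∈C : ∀ i j → x i j ∈ C
    x∈C i j = Equivalence.from (gen (x i j)) (proj₁ (multiple-attained g i (toℕ j)) , refl)

    x-inj : ∀ i → Injective _≡_ _≡_ (λ j → lookup (x i j) i)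
    x-inj i {j} {k} eq with large i
    ... | α , n≤α , d*α≡N = toℕ-injective (*-cancelʳ-≡ (toℕ j) (toℕ k) d {{d≢0}}
      (mod-injective (multiple<N j) (multiple<N k)
        (trans (sym (proj₂ (multiple-attained g i (toℕ j))))
          (trans eq (proj₂ (multiple-attained g i (toℕ k)))))))
      where
      d = gcdColumn N g i

      d≢0 : NonZero d
      d≢0 = m*n≢0⇒m≢0 d {{subst NonZero (sym d*α≡N) it}}

      multiple<N : ∀ j → toℕ j * d < N
      multiple<N j = subst (toℕ j * d <_) (trans (*-comm α d) d*α≡N)
        (*-monoˡ-< d {{d≢0}} (<-≤-trans (toℕ<n j) n≤α))

lemma3p1 : ∀ {ℓ : Level} (N : ℕ) .{{_ : NonZero N}} (C : Pred (Word N 5) ℓ) →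
    IsLinearCode N C → Extended N C → NoZeroCoordinate N C →
    (m : ℕ) (g : Matrix N m 5) → Generates N g C → gcdAll N g ≡ 1 →
    Thin N C →
    ∃[ i ] ∃[ α ] α ∈ˡ (2 ∷ 3 ∷ 4 ∷ []) × gcdColumn N g i * α ≡ N
lemma3p1 N C linear _ nonzero m g gen _ thin with any? small?
  where
  small? : ∀ i → Dec (∃[ α ] α ∈ˡ (2 ∷ 3 ∷ 4 ∷ []) × gcdColumn N g i * α ≡ N)
  small? i = map′ find (λ (_ , α∈ , eq) → lose α∈ eq)
    (anyᴸ? (λ α → gcdColumn N g i * α ≟ N) (2 ∷ 3 ∷ 4 ∷ []))
... | yes result = result
... | no ¬small  = contradiction thin (large-quotients⇒¬thin N linear g gen large)
  where
  quotient≥5 : ∀ i α → gcdColumn N g i * α ≡ N → 5 ≤ α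
  quotient≥5 i 0 eq = contradiction
    (subst (gcdColumn N g i <_) (trans (sym eq) (*-zeroʳ (gcdColumn N g i)))
      (gcdColumn<N N g gen nonzero i))
    n≮0
  quotient≥5 i 1 eq = contradiction
    (trans (sym (*-identityʳ (gcdColumn N g i))) eq)
    (<⇒≢ (gcdColumn<N N g gen nonzero i))
  quotient≥5 i 2 eq = contradiction (i , 2 , here refl , eq) ¬small
  quotient≥5 i 3 eq = contradiction (i , 3 , there (here refl) , eq) ¬small
  quotient≥5 i 4 eq = contradiction (i , 4 , there (there (here refl)) , eq) ¬small
  quotient≥5 i (suc (suc (suc (suc (suc α))))) eq = m≤m+n 5 α

  large : ∀ i → ∃[ α ] 5 ≤ α × gcdColumn N g i * α ≡ N
  large i =
    let d∣N = gcdWith∣N N (map (λ r → lookup r i) g)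
        eq  = sym (m∣n⇒n≡m*quotient d∣N)
    in quotient d∣N , quotient≥5 i (quotient d∣N) eq , eq
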